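{- Let $G=(V,E\cup D,z)$ be a signed graph with interaction matrix $W(G)$, and consider threshold networks on $G$ under the parallel update mode. (i) If there exists a threshold vector $b\in\mathbb{Z}^{V}$ such that the threshold network on $G$ with thresholds $b$ admits a total two-cycle, then $\mathcal{S}(G)\ge 0$. (ii) Conversely, if $\mathcal{S}(G)\ge 0$, then there exists a threshold vector $b\in\mathbb{Z}^{V}$ such that the threshold network on $G$ with thresholds $b$ admits an attractor of period $2$.
   Context: A signed graph $G=(V,E\cup D,z)$ consists of a finite vertex set $V$, a set $E$ of undirected edges between distinct vertices (no multiple edges), a set $D$ of self-loops (at most one per vertex), and a sign map $z:E\cup D\to\{ -1,+1\}$. Write $n=|V|$, $m=|E|$, and $d^{+}$ (resp. $d^{ - }$) for the number of positive (resp. negative) self-loops. The interaction matrix $W(G)=(w_{ij})$ is symmetric with $w_{ij}=z(\{i,j\})$ if $\{i,j\}\in E$, $w_{ii}$ the sign of the loop at $i$ if present, and $0$ otherwise. The sign of a cycle of $(V,E)$ is the product of its edge signs; $G$ is antibalanced if every even cycle of $(V,E)$ is positive and every odd cycle is negative. $\rho(G)$ is the minimum size of $X\subseteq E$ such that the graph with edge set $E\setminus X$ is antibalanced. The stability index is $\mathcal{S}(G)=-n-d^{+}+d^{ - }+2m-4\rho(G)$. The threshold network with thresholds $b$ has local functions $f_i(x)=1$ if $\sum_{j\in V}w_{ij}x_j-b_i>0$, $f_i(x)=x_i$ if this quantity is $0$, $f_i(x)=-1$ otherwise ($x\in\{ -1,1\}^V$), and parallel map $f=(f_i)_{i\in V}$.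 An attractor of period $p$ is a configuration $x$ with $f^p(x)=x$ and $p\ge 1$ minimal. A total two-cycle is a configuration $x$ with $f(f(x))=x$ and $f(x)_i\neq x_i$ for every $i\in V$. -}

module Defs where

open import Data.Nat using (ℕ; zero; suc)
import Data.Nat as N
open import Data.Integer as Z using (ℤ; +_; -_; _+_; _*_; _-_)
open import Data.Fin using (Fin; zero; suc; _<?_; _≟_)
open import Data.Bool using (Bool; true; false; if_then_else_; _∧_; _∨_; not)
open import Data.Maybe using (Maybe; just; nothing; is-just)
open import Data.List using (List; []; _∷_; length)
open import Data.List.Relation.Unary.Unique.Propositional using (Unique)
open import Data.Sign as S using (Sign)
open import Data.Product using (Σ; _×_; _,_)
open import Relation.Nullary using (¬_)
open import Relation.Nullary.Decidable using (⌊_⌋)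
open import Relation.Binary.PropositionalEquality using (_≡_; _≢_)

------------------------------------------------------------------------
-- Signed graphs on vertex set V = Fin n.
-- w i j = nothing : no edge/loop; just s : edge {i,j} (i ≠ j) or loop
-- at i (i = j) with sign s.  Symmetric: undirected, no multi-edges,
-- at most one loop per vertex.

record SignedGraph (n : ℕ) : Set where
  field
    w   : Fin n → Fin n → Maybe Sign
    sym : ∀ i j → w i j ≡ w j i
open SignedGraph public

-- finite sums over Fin n
sumℕ : ∀ {n} → (Fin n → ℕ) → ℕ
sumℕ {zero}  f = 0
sumℕ {suc n} f = f zero N.+ sumℕ (λ i → f (suc i))

sumℤ : ∀ {n} → (Fin n → ℤ) → ℤ
sumℤ {zero}  f = + 0
sumℤ {suc n} f = f zero + sumℤ (λ i → f (suc i))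

-- m = |E| : unordered pairs i < j carrying an edge
numEdges : ∀ {n} → SignedGraph n → ℕ
numEdges G = sumℕ λ i → sumℕ λ j →
  if ⌊ i <? j ⌋ ∧ is-just (w G i j) then 1 else 0

isPosLoop : Maybe Sign → ℕ
isPosLoop (just S.+) = 1
isPosLoop _          = 0

isNegLoop : Maybe Sign → ℕ
isNegLoop (just S.-) = 1
isNegLoop _          = 0

-- d⁺ and d⁻
numPosLoops : ∀ {n} → SignedGraph n → ℕ
numPosLoops G = sumℕ λ i → isPosLoop (w G i i)

numNegLoops : ∀ {n} → SignedGraph n → ℕ
numNegLoops G = sumℕ λ i → isNegLoop (w G i i)

------------------------------------------------------------------------
-- Edge deletion.  A set X ⊆ E is given by a Boolean marking
-- del : Fin n → Fin n → Bool; the edge {i,j} ∈ E belongs to X iff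
-- del i j ∨ del j i (markings on non-edges are ignored).

inX : ∀ {n} → (Fin n → Fin n → Bool) → Fin n → Fin n → Bool
inX del i j = del i j ∨ del j i

-- |X|
sizeX : ∀ {n} → SignedGraph n → (Fin n → Fin n → Bool) → ℕ
sizeX G del = sumℕ λ i → sumℕ λ j →
  if ⌊ i <? j ⌋ ∧ is-just (w G i j) ∧ inX del i j then 1 else 0

-- signed edge set of the graph (V, E \ X) (loops removed: only E counts)
remaining : ∀ {n} → SignedGraph n → (Fin n → Fin n → Bool) →
            Fin n → Fin n → Maybe Sign
remaining G del i j =
  if ⌊ i ≟ j ⌋ then nothing else (if inX del i j then nothing else w G i j)

------------------------------------------------------------------------
-- Cycles and their signs.

_⊗_ : Maybe Sign → Maybe Sign → Maybe Sign
just s ⊗ just t = just (s S.* t)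
_      ⊗ _      = nothing

-- product of the signs of the edges x₀x₁, x₁x₂, …, x_{k-1}x₀ where
-- x₀ = first; nothing if one of them is not an edge.
walkSign : ∀ {n} → (Fin n → Fin n → Maybe Sign) → Fin n → List (Fin n) → Maybe Sign
walkSign e first []            = nothing
walkSign e first (x ∷ [])      = e x first
walkSign e first (x ∷ y ∷ xs)  = e x y ⊗ walkSign e first (y ∷ xs)

cycleSign : ∀ {n} → (Fin n → Fin n → Maybe Sign) → List (Fin n) → Maybe Sign
cycleSign e []       = nothing
cycleSign e (x ∷ xs) = walkSign e x (x ∷ xs)

-- (-1)^k
parity : ℕ → Sign
parity zero    = S.+
parity (suc k) = S.- S.* parity k

-- A cycle is a list of ≥ 3 pairwise distinct vertices, cyclically
-- consecutive ones adjacent (i.e. cycleSign ≡ just s).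
-- Antibalanced: even cycles positive, odd cycles negative.
Antibalanced : ∀ {n} → (Fin n → Fin n → Maybe Sign) → Set
Antibalanced {n} e = ∀ (c : List (Fin n)) (s : Sign) → Unique c → 3 N.≤ length c →
  cycleSign e c ≡ just s → s ≡ parity (length c)

-- r = ρ(G): minimum size of X ⊆ E with (V, E \ X) antibalanced.
IsRho : ∀ {n} → SignedGraph n → ℕ → Set
IsRho {n} G r =
  (Σ (Fin n → Fin n → Bool) λ del →
      sizeX G del ≡ r × Antibalanced (remaining G del))
  × (∀ (del : Fin n → Fin n → Bool) →
      Antibalanced (remaining G del) → r N.≤ sizeX G del)

-- stability index S(G) = -n - d⁺ + d⁻ + 2m - 4ρ, with ρ given as r
stabilityIndex : ∀ {n} → SignedGraph n → ℕ → ℤ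
stabilityIndex {n} G r =
  - (+ n) - (+ numPosLoops G) + (+ numNegLoops G)
  + (+ 2) * (+ numEdges G) - (+ 4) * (+ r)

------------------------------------------------------------------------
-- Threshold networks (parallel update).

Config : ℕ → Set
Config n = Fin n → Sign

signℤ : Sign → ℤ
signℤ S.+ = + 1
signℤ S.- = - (+ 1)

-- interaction matrix W(G)
W : ∀ {n} → SignedGraph n → Fin n → Fin n → ℤ
W G i j with w G i j
... | nothing = + 0
... | just s  = signℤ s

decide : ℤ → Sign → Sign
decide (+ zero)   xi = xi
decide (+ suc _)  xi = S.+
decide Z.-[1+ _ ] xi = S.-

-- parallel map f of the threshold network on G with thresholds b
step : ∀ {n} → SignedGraph n → (Fin n → ℤ) → Config n → Config n
step G b x i = decide (sumℤ (λ j → W G i j * signℤ (x j)) - b i) (x i)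

-- total two-cycle: f(f(x)) = x and f(x)ᵢ ≠ xᵢ for all i
TotalTwoCycle : ∀ {n} → SignedGraph n → (Fin n → ℤ) → Config n → Set
TotalTwoCycle {n} G b x =
  (∀ i → step G b (step G b x) i ≡ x i) × (∀ (i : Fin n) → step G b x i ≢ x i)

-- attractor of period 2: f²(x) = x and f(x) ≠ x (minimal p = 2)
Period2 : ∀ {n} → SignedGraph n → (Fin n → ℤ) → Config n → Set
Period2 {n} G b x =
  (∀ i → step G b (step G b x) i ≡ x i) × ¬ (∀ (i : Fin n) → step G b x i ≡ x i)

-- Write h_i(x) = Σ_j w_ij x_j for the local field and E(x) = Σ_i x_i h_i(x) for the energy of a
-- configuration x. Call an edge frustrated by x when its sign is x_i x_j; then E(x) = 2(2k - m) + d⁺ - d⁻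
-- with k the number of frustrated edges. Deleting the frustrated edges leaves an antibalanced graph, and
-- conversely Harary's balance theorem, applied to the negated graph, gives for every antibalanced E ∖ X a
-- configuration all of whose frustrated edges lie in X. Hence the least energy is 4ρ - 2m + d⁺ - d⁻ = -n - S(G).
--
-- In a total two-cycle every x_i disagrees with h_i(x) - b_i and, after the flip, -x_i disagrees with
-- -h_i(x) - b_i; adding the two gives x_i h_i(x) ≤ -1, so E(x) ≤ -n and S(G) ≥ 0. Conversely, if S(G) ≥ 0
-- an energy minimiser has E(x) ≤ -n. Repeatedly discarding from A = V a vertex i with
-- Σ_{j∈A} x_i w_ij x_j ≥ 0 keeps Σ_{i,j∈A} x_i w_ij x_j + |A| ≤ 0, so it stops at a nonempty A all of
-- whose vertices have negative row sums within A. Thresholds b_i = h_i(x) + x_i on A, and between h_i(x)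
-- and h_i(x′) elsewhere, make the network alternate between x and its flip x′ on A.
module Submission where

open import Defs
open import Data.Nat using (ℕ; _≤_)
open import Data.Integer using (ℤ; +_) renaming (_≤_ to _≤ℤ_)
open import Data.Fin using (Fin)
open import Data.Product using (Σ; _×_)

import Algebra.Properties.CommutativeSemigroup as CommSemigroupProperties
open import Data.Bool using (Bool; true; false; if_then_else_; _∧_; _∨_)
import Data.Bool.Properties as Bool
open import Data.Bool.Properties using (∨-comm; ∨-conicalˡ; ∨-idem)
open import Data.Empty using (⊥-elim)
open import Data.Fin using (zero; suc; _≟_; _<?_)
open import Data.Fin.Properties using (any?; <⇒≢; <-cmp; suc-injective)
open import Data.Integer using (_+_; _*_; _-_; -_; _⊓_; _⊔_; 0ℤ; 1ℤ; -1ℤ; -[1+_]; +≤+; -≤-; -≤+)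
import Data.Integer.Properties as ℤ
open import Data.Integer.Tactic.RingSolver using (solve-∀)
open import Data.List using (List; []; _∷_; _++_; [_]; length)
open import Data.List.Properties using (++-assoc; ++-identityʳ; length-++; length-++-comm)
import Data.List.Membership.DecPropositional as DecMembership
open import Data.List.Membership.Propositional.Properties using (∈-∃++)
open import Data.List.Relation.Unary.All.Properties using (¬Any⇒All¬)
open import Data.List.Relation.Unary.AllPairs using ([]; _∷_)
open import Data.List.Relation.Unary.Unique.Propositional using (Unique)
open import Data.Maybe using (Maybe; just; nothing; is-just; _<∣>_)
open import Data.Nat using (zero; suc; _<_; z≤n; s≤s) renaming (_+_ to _+ℕ_)
import Data.Nat.Properties as ℕ
open import Data.Product using (∃; ∃₂; _,_; proj₁; proj₂)
open import Data.Sign using (Sign; opposite)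
import Data.Sign as S
import Data.Sign.Properties as S
open import Data.Sum using (_⊎_; inj₁; inj₂)
import Data.Vec.Functional as Vector
open import Function using (_∘_)
open import Relation.Binary.Definitions using (tri<; tri≈; tri>)
open import Relation.Binary.PropositionalEquality as ≡
  using (_≡_; _≢_; refl; trans; cong; cong₂; subst; module ≡-Reasoning)
open import Relation.Nullary using (Dec; yes; no; ¬_)
open import Relation.Nullary.Decidable using (⌊_⌋; isYes≗does; dec-true; dec-false; _×-dec_)

-- Signs

private
  module SignAlgebra = CommSemigroupProperties S.*-commutativeSemigroup

s*[s*t]≡t : ∀ s t → s S.* (s S.* t) ≡ t
s*[s*t]≡t s t = trans (≡.sym (S.*-assoc s s t)) (cong (S._* t) (S.s*s≡+ s))

s*t≡u⇒t≡s*u : ∀ s {t u} → s S.* t ≡ u → t ≡ s S.* u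
s*t≡u⇒t≡s*u s {t} eq = trans (≡.sym (s*[s*t]≡t s t)) (cong (s S.*_) eq)

s*t≡+⇒t≡s : ∀ {s t} → s S.* t ≡ S.+ → t ≡ s
s*t≡+⇒t≡s {s} eq = trans (s*t≡u⇒t≡s*u s eq) (S.*-identityʳ s)

s*[t*u]≡+⇒s*u≡t : ∀ s t u → s S.* (t S.* u) ≡ S.+ → s S.* u ≡ t
s*[t*u]≡+⇒s*u≡t s t u eq = s*t≡+⇒t≡s (trans (≡.sym (SignAlgebra.x∙yz≈y∙xz s t u)) eq)

[s*t]*[t*u]≡s*u : ∀ s t u → (s S.* t) S.* (t S.* u) ≡ s S.* u
[s*t]*[t*u]≡s*u s t u = begin
  (s S.* t) S.* (t S.* u)   ≡⟨ S.*-assoc s t (t S.* u) ⟩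
  s S.* (t S.* (t S.* u))   ≡⟨ cong (s S.*_) (s*[s*t]≡t t u) ⟩
  s S.* u                   ∎
  where open ≡-Reasoning

s≢t⇒s≡opposite[t] : ∀ {s t} → s ≢ t → s ≡ opposite t
s≢t⇒s≡opposite[t] {S.+} {S.+} s≢t = ⊥-elim (s≢t refl)
s≢t⇒s≡opposite[t] {S.+} {S.-} _   = refl
s≢t⇒s≡opposite[t] {S.-} {S.+} _   = refl
s≢t⇒s≡opposite[t] {S.-} {S.-} s≢t = ⊥-elim (s≢t refl)

s≢t⇒s*-≡t : ∀ {s t} → s ≢ t → s S.* S.- ≡ t
s≢t⇒s*-≡t {s} {t} s≢t = trans (S.*-comm s S.-) (trans (cong opposite (s≢t⇒s≡opposite[t] s≢t)) (S.opposite-involutive t))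

s*-≢s : ∀ s → s S.* S.- ≢ s
s*-≢s S.+ ()
s*-≢s S.- ()

⊗-identityʳ : ∀ a → a ⊗ just S.+ ≡ a
⊗-identityʳ (just s) = cong just (S.*-identityʳ s)
⊗-identityʳ nothing  = refl

⊗-assoc : ∀ a b c → (a ⊗ b) ⊗ c ≡ a ⊗ (b ⊗ c)
⊗-assoc (just a) (just b) (just c) = cong just (S.*-assoc a b c)
⊗-assoc (just a) (just b) nothing  = refl
⊗-assoc (just a) nothing  c        = refl
⊗-assoc nothing  b        c        = refl

⊗-comm : ∀ a b → a ⊗ b ≡ b ⊗ a
⊗-comm (just a) (just b) = cong just (S.*-comm a b)
⊗-comm (just a) nothing  = refl
⊗-comm nothing  (just b) = refl
⊗-comm nothing  nothing  = refl

⊗-interchange : ∀ a b c d → (a ⊗ b) ⊗ (c ⊗ d) ≡ (a ⊗ c) ⊗ (b ⊗ d)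
⊗-interchange (just a) (just b) (just c) (just d) = cong just (SignAlgebra.interchange a b c d)
⊗-interchange (just a) (just b) (just c) nothing  = refl
⊗-interchange (just a) (just b) nothing  d        = refl
⊗-interchange (just a) nothing  (just c) d        = refl
⊗-interchange (just a) nothing  nothing  d        = refl
⊗-interchange nothing  b        c        d        = refl

just? : ∀ (m : Maybe Sign) → Dec (∃ λ s → m ≡ just s)
just? (just s) = yes (s , refl)
just? nothing  = no λ ()

⊗≡just : ∀ {a b s} → a ⊗ b ≡ just s → ∃₂ λ t u → a ≡ just t × b ≡ just u × s ≡ t S.* u
⊗≡just {just t} {just u} refl = t , u , refl , refl , refl

-- Signed paths and closed walks

EdgeSigns : ℕ → Set
EdgeSigns n = Fin n → Fin n → Maybe Sign

module _ {n : ℕ} where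

  pathSign : EdgeSigns n → Fin n → List (Fin n) → Maybe Sign
  pathSign e v []       = just S.+
  pathSign e v (w ∷ ws) = e v w ⊗ pathSign e w ws

  IsSymmetric : EdgeSigns n → Set
  IsSymmetric e = ∀ u v → e u v ≡ e v u

  Loopless : EdgeSigns n → Set
  Loopless e = ∀ v → e v v ≡ nothing

  -- closed walks in which vertices may repeat, unlike the cycles of Antibalanced
  BalancedWalks : EdgeSigns n → Set
  BalancedWalks e = ∀ c s → cycleSign e c ≡ just s → s ≡ S.+

  AntibalancedWalks : EdgeSigns n → Set
  AntibalancedWalks e = ∀ c s → cycleSign e c ≡ just s → s ≡ parity (length c)

  module _ (e : EdgeSigns n) where

    pathSign-++ : ∀ v xs w ys → pathSign e v (xs ++ w ∷ ys) ≡ pathSign e v (xs ++ [ w ]) ⊗ pathSign e w ys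
    pathSign-++ v []       w ys = cong (_⊗ pathSign e w ys) (≡.sym (⊗-identityʳ (e v w)))
    pathSign-++ v (x ∷ xs) w ys = begin
      e v x ⊗ pathSign e x (xs ++ w ∷ ys)                         ≡⟨ cong (e v x ⊗_) (pathSign-++ x xs w ys) ⟩
      e v x ⊗ (pathSign e x (xs ++ [ w ]) ⊗ pathSign e w ys)      ≡⟨ ≡.sym (⊗-assoc (e v x) _ _) ⟩
      (e v x ⊗ pathSign e x (xs ++ [ w ])) ⊗ pathSign e w ys      ∎
      where open ≡-Reasoning

    cycleSign-∷ : ∀ v ws → cycleSign e (v ∷ ws) ≡ pathSign e v (ws ++ [ v ])
    cycleSign-∷ v ws = walk v ws
      where
      walk : ∀ x xs → walkSign e v (x ∷ xs) ≡ pathSign e x (xs ++ [ v ])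
      walk x []       = ≡.sym (⊗-identityʳ (e x v))
      walk x (y ∷ ys) = cong (e x y ⊗_) (walk y ys)

    cycleSign-rotate : ∀ xs ys → cycleSign e (xs ++ ys) ≡ cycleSign e (ys ++ xs)
    cycleSign-rotate []       ys = cong (cycleSign e) (≡.sym (++-identityʳ ys))
    cycleSign-rotate (x ∷ xs) ys = begin
      cycleSign e (x ∷ xs ++ ys)           ≡⟨ rotate₁ x (xs ++ ys) ⟩
      cycleSign e ((xs ++ ys) ++ [ x ])    ≡⟨ cong (cycleSign e) (++-assoc xs ys [ x ]) ⟩
      cycleSign e (xs ++ ys ++ [ x ])      ≡⟨ cycleSign-rotate xs (ys ++ [ x ]) ⟩
      cycleSign e ((ys ++ [ x ]) ++ xs)    ≡⟨ cong (cycleSign e) (++-assoc ys [ x ] xs) ⟩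
      cycleSign e (ys ++ x ∷ xs)           ∎
      where
      open ≡-Reasoning
      rotate₁ : ∀ x ys → cycleSign e (x ∷ ys) ≡ cycleSign e (ys ++ [ x ])
      rotate₁ x []       = refl
      rotate₁ x (y ∷ ys) = begin
        cycleSign e (x ∷ y ∷ ys)                              ≡⟨ cycleSign-∷ x (y ∷ ys) ⟩
        e x y ⊗ pathSign e y (ys ++ [ x ])                    ≡⟨ ⊗-comm (e x y) _ ⟩
        pathSign e y (ys ++ [ x ]) ⊗ e x y                    ≡⟨ cong (pathSign e y (ys ++ [ x ]) ⊗_) (≡.sym (⊗-identityʳ (e x y))) ⟩
        pathSign e y (ys ++ [ x ]) ⊗ pathSign e x [ y ]       ≡⟨ ≡.sym (pathSign-++ y ys x [ y ]) ⟩
        pathSign e y (ys ++ x ∷ [ y ])                        ≡⟨ cong (pathSign e y) (≡.sym (++-assoc ys [ x ] [ y ])) ⟩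
        pathSign e y ((ys ++ [ x ]) ++ [ y ])                 ≡⟨ ≡.sym (cycleSign-∷ y (ys ++ [ x ])) ⟩
        cycleSign e (y ∷ ys ++ [ x ])                         ∎

    cycleSign-split : ∀ u xs ys → cycleSign e (u ∷ xs ++ u ∷ ys) ≡ cycleSign e (u ∷ xs) ⊗ cycleSign e (u ∷ ys)
    cycleSign-split u xs ys = begin
      cycleSign e (u ∷ xs ++ u ∷ ys)                            ≡⟨ cycleSign-∷ u (xs ++ u ∷ ys) ⟩
      pathSign e u ((xs ++ u ∷ ys) ++ [ u ])                    ≡⟨ cong (pathSign e u) (++-assoc xs (u ∷ ys) [ u ]) ⟩
      pathSign e u (xs ++ u ∷ ys ++ [ u ])                      ≡⟨ pathSign-++ u xs u (ys ++ [ u ]) ⟩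
      pathSign e u (xs ++ [ u ]) ⊗ pathSign e u (ys ++ [ u ])   ≡⟨ ≡.sym (cong₂ _⊗_ (cycleSign-∷ u xs) (cycleSign-∷ u ys)) ⟩
      cycleSign e (u ∷ xs) ⊗ cycleSign e (u ∷ ys)               ∎
      where open ≡-Reasoning

parity-+ : ∀ a b → parity (a +ℕ b) ≡ parity a S.* parity b
parity-+ zero    b = refl
parity-+ (suc a) b = trans (cong (S.- S.*_) (parity-+ a b)) (≡.sym (S.*-assoc S.- (parity a) (parity b)))

module _ {n : ℕ} where

  open DecMembership (_≟_ {n}) using (_∈?_)

  Repeats : List (Fin n) → Set
  Repeats c = ∃₂ λ xs u → ∃₂ λ ys zs → c ≡ xs ++ u ∷ ys ++ u ∷ zs

  unique⊎repeats : ∀ c → Unique c ⊎ Repeats c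
  unique⊎repeats []       = inj₁ []
  unique⊎repeats (x ∷ xs) with x ∈? xs | unique⊎repeats xs
  ... | yes x∈xs | _ = let ys , zs , eq = ∈-∃++ x∈xs in inj₂ ([] , x , ys , zs , cong (x ∷_) eq)
  ... | no  x∉xs | inj₁ unique = inj₁ (¬Any⇒All¬ xs x∉xs ∷ unique)
  ... | no  _    | inj₂ (as , u , ys , zs , eq) = inj₂ (x ∷ as , u , ys , zs , cong (x ∷_) eq)

  module _ (e : EdgeSigns n) where

    cycleSign-repeat : ∀ xs u ys zs →
      cycleSign e (xs ++ u ∷ ys ++ u ∷ zs) ≡ cycleSign e (u ∷ ys) ⊗ cycleSign e (u ∷ zs ++ xs)
    cycleSign-repeat xs u ys zs = begin
      cycleSign e (xs ++ u ∷ ys ++ u ∷ zs)    ≡⟨ cycleSign-rotate e xs (u ∷ ys ++ u ∷ zs) ⟩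
      cycleSign e ((u ∷ ys ++ u ∷ zs) ++ xs)  ≡⟨ cong (λ l → cycleSign e (u ∷ l)) (++-assoc ys (u ∷ zs) xs) ⟩
      cycleSign e (u ∷ ys ++ u ∷ zs ++ xs)    ≡⟨ cycleSign-split e u ys (zs ++ xs) ⟩
      cycleSign e (u ∷ ys) ⊗ cycleSign e (u ∷ zs ++ xs) ∎
      where open ≡-Reasoning

    length-repeat : ∀ xs (u : Fin n) ys zs →
      length (xs ++ u ∷ ys ++ u ∷ zs) ≡ length (u ∷ ys) +ℕ length (u ∷ zs ++ xs)
    length-repeat xs u ys zs = begin
      length (xs ++ u ∷ ys ++ u ∷ zs)    ≡⟨ length-++-comm xs (u ∷ ys ++ u ∷ zs) ⟩
      length ((u ∷ ys ++ u ∷ zs) ++ xs)  ≡⟨ cong (λ l → length (u ∷ l)) (++-assoc ys (u ∷ zs) xs) ⟩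
      suc (length (ys ++ u ∷ zs ++ xs))  ≡⟨ cong suc (length-++ ys) ⟩
      length (u ∷ ys) +ℕ length (u ∷ zs ++ xs) ∎
      where open ≡-Reasoning

    -- A closed walk with a repeated vertex splits there into two shorter closed walks; one without
    -- is a cycle or runs back and forth along a single edge.
    antibalanced⇒antibalancedWalks : IsSymmetric e → Loopless e → Antibalanced e → AntibalancedWalks e
    antibalanced⇒antibalancedWalks symmetric loopless antibalanced c = walks (suc (length c)) c ℕ.≤-refl
      where
      repetitionFree : ∀ c → Unique c → ∀ s → cycleSign e c ≡ just s → s ≡ parity (length c)
      repetitionFree [] _ s ()
      repetitionFree (v ∷ []) _ s eq with () ← trans (≡.sym (loopless v)) eq
      repetitionFree (v ∷ a ∷ []) _ s eq with ⊗≡just {e v a} eq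
      ... | t , u , eva , eav , refl with trans (≡.sym eva) (trans (symmetric v a) eav)
      ...   | refl = S.s*s≡+ t
      repetitionFree c@(_ ∷ _ ∷ _ ∷ _) unique s eq = antibalanced c s unique (s≤s (s≤s (s≤s z≤n))) eq

      walks : ∀ bound c → length c < bound → ∀ s → cycleSign e c ≡ just s → s ≡ parity (length c)
      walks (suc bound) c len s eq with unique⊎repeats c
      ... | inj₁ unique = repetitionFree c unique s eq
      ... | inj₂ (xs , u , ys , zs , refl)
        with ⊗≡just {cycleSign e (u ∷ ys)} (trans (≡.sym (cycleSign-repeat xs u ys zs)) eq)
      ... | t₁ , t₂ , eq₁ , eq₂ , refl = begin
        t₁ S.* t₂                                                   ≡⟨ cong₂ S._*_ (walks bound (u ∷ ys) len₁ t₁ eq₁) (walks bound (u ∷ zs ++ xs) len₂ t₂ eq₂) ⟩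
        parity (length (u ∷ ys)) S.* parity (length (u ∷ zs ++ xs)) ≡⟨ ≡.sym (parity-+ (length (u ∷ ys)) _) ⟩
        parity (length (u ∷ ys) +ℕ length (u ∷ zs ++ xs))            ≡⟨ cong parity (≡.sym (length-repeat xs u ys zs)) ⟩
        parity (length (xs ++ u ∷ ys ++ u ∷ zs))                    ∎
        where
        open ≡-Reasoning
        len′ : length (u ∷ ys) +ℕ length (u ∷ zs ++ xs) ≤ bound
        len′ = ℕ.≤-pred (subst (_< suc bound) (length-repeat xs u ys zs) len)
        len₁ : length (u ∷ ys) < bound
        len₁ = ℕ.≤-trans (s≤s (ℕ.m≤m+n (length (u ∷ ys)) _)) (subst (_≤ bound) (ℕ.+-suc (length (u ∷ ys)) _) len′)
        len₂ : length (u ∷ zs ++ xs) < bound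
        len₂ = ℕ.≤-trans (s≤s (ℕ.m≤n+m _ (length ys))) len′

-- Balance and switchings

module _ {n : ℕ} where

  negate : EdgeSigns n → EdgeSigns n
  negate e u v = e u v ⊗ just S.-

  SignedBy : EdgeSigns n → Config n → Set
  SignedBy e x = ∀ u v s → e u v ≡ just s → s ≡ x u S.* x v

  module _ (e : EdgeSigns n) where

    pathSign-negate : ∀ v ws → pathSign (negate e) v ws ≡ pathSign e v ws ⊗ just (parity (length ws))
    pathSign-negate v []       = refl
    pathSign-negate v (w ∷ ws) = begin
      (e v w ⊗ just S.-) ⊗ pathSign (negate e) w ws                       ≡⟨ cong ((e v w ⊗ just S.-) ⊗_) (pathSign-negate w ws) ⟩
      (e v w ⊗ just S.-) ⊗ (pathSign e w ws ⊗ just (parity (length ws)))  ≡⟨ ⊗-interchange (e v w) (just S.-) (pathSign e w ws) _ ⟩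
      (e v w ⊗ pathSign e w ws) ⊗ just (parity (suc (length ws)))          ∎
      where open ≡-Reasoning

    cycleSign-negate : ∀ c → cycleSign (negate e) c ≡ cycleSign e c ⊗ just (parity (length c))
    cycleSign-negate []       = refl
    cycleSign-negate (v ∷ ws) = begin
      cycleSign (negate e) (v ∷ ws)                                       ≡⟨ cycleSign-∷ (negate e) v ws ⟩
      pathSign (negate e) v (ws ++ [ v ])                                 ≡⟨ pathSign-negate v (ws ++ [ v ]) ⟩
      pathSign e v (ws ++ [ v ]) ⊗ just (parity (length (ws ++ [ v ])))   ≡⟨ cong₂ (λ p l → p ⊗ just (parity l)) (≡.sym (cycleSign-∷ e v ws)) (length-++-comm ws [ v ]) ⟩
      cycleSign e (v ∷ ws) ⊗ just (parity (length (v ∷ ws)))             ∎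
      where open ≡-Reasoning

    antibalancedWalks⇒balancedWalks-negate : AntibalancedWalks e → BalancedWalks (negate e)
    antibalancedWalks⇒balancedWalks-negate antibalanced c s eq
      with ⊗≡just {cycleSign e c} (trans (≡.sym (cycleSign-negate c)) eq)
    ... | t , _ , eqt , refl , refl rewrite antibalanced c t eqt = S.s*s≡+ (parity (length c))

    balancedWalks-negate⇒antibalancedWalks : BalancedWalks (negate e) → AntibalancedWalks e
    balancedWalks-negate⇒antibalancedWalks balanced c s eq =
      ≡.sym (s*t≡+⇒t≡s (balanced c _ (trans (cycleSign-negate c) (cong (_⊗ just (parity (length c))) eq))))

    signedBy⇒pathSign : ∀ x → SignedBy e x → ∀ v ws u s → pathSign e v (ws ++ [ u ]) ≡ just s → s ≡ x v S.* x u
    signedBy⇒pathSign x signed v []       u s eq = signed v u s (trans (≡.sym (⊗-identityʳ (e v u))) eq)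
    signedBy⇒pathSign x signed v (w ∷ ws) u s eq with ⊗≡just {e v w} eq
    ... | t₁ , t₂ , eq₁ , eq₂ , refl
      rewrite signed v w t₁ eq₁ | signedBy⇒pathSign x signed w ws u t₂ eq₂ = [s*t]*[t*u]≡s*u (x v) (x w) (x u)

    signedBy⇒balancedWalks : ∀ x → SignedBy e x → BalancedWalks e
    signedBy⇒balancedWalks x signed (v ∷ ws) s eq =
      trans (signedBy⇒pathSign x signed v ws v s (trans (≡.sym (cycleSign-∷ e v ws)) eq)) (S.s*s≡+ (x v))

-- Vertex zero is eliminated by joining any two of its neighbours that are not already adjacent by an
-- edge carrying the sign of the path through zero; closed walks of the reduced graph lift to closed walks.
module VertexElimination {n : ℕ} (e : EdgeSigns (suc n)) (symmetric : IsSymmetric e) where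

  link : Fin n → Maybe Sign
  link u = e zero (suc u)

  reduced : EdgeSigns n
  reduced u w = e (suc u) (suc w) <∣> (link u ⊗ link w)

  reduced-symmetric : IsSymmetric reduced
  reduced-symmetric u w = cong₂ _<∣>_ (symmetric (suc u) (suc w)) (⊗-comm (link u) (link w))

  detour : Maybe Sign → List (Fin (suc n))
  detour (just _) = []
  detour nothing  = [ zero ]

  lift : Fin n → List (Fin n) → List (Fin (suc n))
  lift v []       = []
  lift v (w ∷ ws) = detour (e (suc v) (suc w)) ++ suc w ∷ lift w ws

  lift-step : ∀ v w → pathSign e (suc v) (detour (e (suc v) (suc w)) ++ [ suc w ]) ≡ reduced v w
  lift-step v w with e (suc v) (suc w) in direct
  ... | just t  rewrite direct = ⊗-identityʳ (just t)
  ... | nothing = cong₂ _⊗_ (symmetric (suc v) zero) (⊗-identityʳ (link w))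

  lift-sign : ∀ v ws → pathSign e (suc v) (lift v ws) ≡ pathSign reduced v ws
  lift-sign v []       = refl
  lift-sign v (w ∷ ws) = begin
    pathSign e (suc v) (via ++ suc w ∷ lift w ws)                      ≡⟨ pathSign-++ e (suc v) via (suc w) (lift w ws) ⟩
    pathSign e (suc v) (via ++ [ suc w ]) ⊗ pathSign e (suc w) (lift w ws) ≡⟨ cong₂ _⊗_ (lift-step v w) (lift-sign w ws) ⟩
    reduced v w ⊗ pathSign reduced w ws                                ∎
    where
    open ≡-Reasoning
    via : List (Fin (suc n))
    via = detour (e (suc v) (suc w))

  lift-∷ʳ : ∀ v ws u → ∃ λ zs → lift v (ws ++ [ u ]) ≡ zs ++ [ suc u ]
  lift-∷ʳ v []       u = detour (e (suc v) (suc u)) , refl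
  lift-∷ʳ v (w ∷ ws) u =
    let zs , eq = lift-∷ʳ w ws u
        via = detour (e (suc v) (suc w))
    in via ++ suc w ∷ zs , trans (cong (λ l → via ++ suc w ∷ l) eq) (≡.sym (++-assoc via (suc w ∷ zs) [ suc u ]))

  reduced-balanced : BalancedWalks e → BalancedWalks reduced
  reduced-balanced balanced (v ∷ ws) s eq =
    let zs , lifted = lift-∷ʳ v ws v
    in balanced (suc v ∷ zs) s (begin
      cycleSign e (suc v ∷ zs)                    ≡⟨ cycleSign-∷ e (suc v) zs ⟩
      pathSign e (suc v) (zs ++ [ suc v ])        ≡⟨ cong (pathSign e (suc v)) (≡.sym lifted) ⟩
      pathSign e (suc v) (lift v (ws ++ [ v ]))   ≡⟨ lift-sign v (ws ++ [ v ]) ⟩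
      pathSign reduced v (ws ++ [ v ])            ≡⟨ ≡.sym (cycleSign-∷ reduced v ws) ⟩
      cycleSign reduced (v ∷ ws)                  ≡⟨ eq ⟩
      just s                                      ∎)
    where open ≡-Reasoning

  module Extension (balanced : BalancedWalks e) (x : Config n) (signed : SignedBy reduced x) where

    links-agree : ∀ u p w q → link u ≡ just p → link w ≡ just q → p S.* q ≡ x u S.* x w
    links-agree u p w q eu ew with e (suc u) (suc w) in direct
    ... | just t = trans triangle (signed u w t (cong (_<∣> (link u ⊗ link w)) direct))
      where
      closed : cycleSign e (zero ∷ suc u ∷ suc w ∷ []) ≡ just (p S.* (t S.* q))
      closed rewrite eu | direct | ≡.sym (symmetric zero (suc w)) | ew = refl
      triangle : p S.* q ≡ t
      triangle = s*[t*u]≡+⇒s*u≡t p t q (balanced (zero ∷ suc u ∷ suc w ∷ []) _ closed)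
    ... | nothing = signed u w (p S.* q) (cong₂ _<∣>_ direct (cong₂ _⊗_ eu ew))

    root : Σ Sign λ r → ∀ w q → link w ≡ just q → q ≡ r S.* x w
    root with any? (λ u → just? (link u))
    ... | yes (u , p , eu) = p S.* x u , λ w q ew →
      trans (s*t≡u⇒t≡s*u p (links-agree u p w q eu ew)) (≡.sym (S.*-assoc p (x u) (x w)))
    ... | no unlinked = S.+ , λ w q ew → ⊥-elim (unlinked (w , q , ew))

    extension : Config (suc n)
    extension = proj₁ root Vector.∷ x

    extension-signed : SignedBy e extension
    extension-signed zero    zero    s eq = trans (balanced [ zero ] s eq) (≡.sym (S.s*s≡+ (proj₁ root)))
    extension-signed zero    (suc w) s eq = proj₂ root w s eq
    extension-signed (suc u) zero    s eq =
      trans (proj₂ root u s (trans (symmetric zero (suc u)) eq)) (S.*-comm (proj₁ root) (x u))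
    extension-signed (suc u) (suc w) s eq = signed u w s (cong (_<∣> (link u ⊗ link w)) eq)

balancedWalks⇒signedBy : ∀ {n} (e : EdgeSigns n) → IsSymmetric e → BalancedWalks e → ∃ (SignedBy e)
balancedWalks⇒signedBy {zero}  e _ _ = (λ ()) , λ ()
balancedWalks⇒signedBy {suc n} e symmetric balanced =
  let x , signed = balancedWalks⇒signedBy reduced reduced-symmetric (reduced-balanced balanced)
  in extension balanced x signed , extension-signed balanced x signed
  where open VertexElimination e symmetric
        open Extension

-- Finite sums

sumℤ-cong : ∀ {n} {f g : Fin n → ℤ} → (∀ i → f i ≡ g i) → sumℤ f ≡ sumℤ g
sumℤ-cong {zero}  eq = refl
sumℤ-cong {suc n} eq = cong₂ _+_ (eq zero) (sumℤ-cong (λ i → eq (suc i)))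

private
  module IntegerAddition = CommSemigroupProperties ℤ.+-commutativeSemigroup

sumℤ-distrib-+ : ∀ {n} (f g : Fin n → ℤ) → sumℤ (λ i → f i + g i) ≡ sumℤ f + sumℤ g
sumℤ-distrib-+ {zero}  f g = refl
sumℤ-distrib-+ {suc n} f g = trans (cong (_+_ (f zero + g zero)) (sumℤ-distrib-+ (λ i → f (suc i)) (λ i → g (suc i))))
                                   (IntegerAddition.interchange (f zero) (g zero) _ _)

sumℤ-neg : ∀ {n} (f : Fin n → ℤ) → sumℤ (λ i → - f i) ≡ - sumℤ f
sumℤ-neg {zero}  f = refl
sumℤ-neg {suc n} f = trans (cong (_+_ (- f zero)) (sumℤ-neg (λ i → f (suc i)))) (≡.sym (ℤ.neg-distrib-+ (f zero) _))

sumℤ-distrib-- : ∀ {n} (f g : Fin n → ℤ) → sumℤ (λ i → f i - g i) ≡ sumℤ f - sumℤ g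
sumℤ-distrib-- f g = trans (sumℤ-distrib-+ f (λ i → - g i)) (cong (_+_ (sumℤ f)) (sumℤ-neg g))

*-distribˡ-sumℤ : ∀ {n} c (f : Fin n → ℤ) → c * sumℤ f ≡ sumℤ (λ i → c * f i)
*-distribˡ-sumℤ {zero}  c f = ℤ.*-zeroʳ c
*-distribˡ-sumℤ {suc n} c f = trans (ℤ.*-distribˡ-+ c (f zero) _) (cong (_+_ (c * f zero)) (*-distribˡ-sumℤ c (λ i → f (suc i))))

sumℤ-zero : ∀ n → sumℤ {n} (λ _ → 0ℤ) ≡ 0ℤ
sumℤ-zero zero    = refl
sumℤ-zero (suc n) = trans (ℤ.+-identityˡ _) (sumℤ-zero n)

sumℤ-const : ∀ n c → sumℤ {n} (λ _ → c) ≡ + n * c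
sumℤ-const zero    c = refl
sumℤ-const (suc n) c = trans (cong (_+_ (c)) (sumℤ-const n c)) (lemma c (+ n))
  where
  lemma : ∀ c m → c + m * c ≡ (1ℤ + m) * c
  lemma = solve-∀

sumℤ-comm : ∀ {m n} (f : Fin m → Fin n → ℤ) → sumℤ (λ i → sumℤ (f i)) ≡ sumℤ (λ j → sumℤ (λ i → f i j))
sumℤ-comm {zero}  {n} f = ≡.sym (sumℤ-zero n)
sumℤ-comm {suc m} f = trans (cong (_+_ (sumℤ (f zero))) (sumℤ-comm (λ i → f (suc i))))
                            (≡.sym (sumℤ-distrib-+ (f zero) _))

sumℤ-single : ∀ {n} (f : Fin n → ℤ) i → (∀ j → j ≢ i → f j ≡ 0ℤ) → sumℤ f ≡ f i
sumℤ-single {suc n} f zero    others = trans (cong (_+_ (f zero)) rest) (ℤ.+-identityʳ (f zero))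
  where
  rest : sumℤ (λ j → f (suc j)) ≡ 0ℤ
  rest = trans (sumℤ-cong (λ j → others (suc j) λ ())) (sumℤ-zero n)
sumℤ-single {suc n} f (suc i) others =
  trans (cong (_+ sumℤ (λ j → f (suc j))) (others zero λ ()))
  (trans (ℤ.+-identityˡ _)
         (sumℤ-single (λ j → f (suc j)) i (λ j j≢i → others (suc j) (j≢i ∘ suc-injective))))

+-sumℕ : ∀ {n} (f : Fin n → ℕ) → + sumℕ f ≡ sumℤ (λ i → + f i)
+-sumℕ {zero}  f = refl
+-sumℕ {suc n} f = trans (ℤ.pos-+ (f zero) _) (cong (_+_ (+ f zero)) (+-sumℕ (λ i → f (suc i))))

sumℕ-mono-≤ : ∀ {n} {f g : Fin n → ℕ} → (∀ i → f i ≤ g i) → sumℕ f ≤ sumℕ g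
sumℕ-mono-≤ {zero}  le = z≤n
sumℕ-mono-≤ {suc n} le = ℕ.+-mono-≤ (le zero) (sumℕ-mono-≤ (λ i → le (suc i)))

sumℤ-mono-≤ : ∀ {n} {f g : Fin n → ℤ} → (∀ i → f i ≤ℤ g i) → sumℤ f ≤ℤ sumℤ g
sumℤ-mono-≤ {zero}  le = ℤ.≤-refl
sumℤ-mono-≤ {suc n} le = ℤ.+-mono-≤ (le zero) (sumℤ-mono-≤ (λ i → le (suc i)))

sumℤ-nonneg : ∀ {n} {f : Fin n → ℤ} → (∀ i → 0ℤ ≤ℤ f i) → 0ℤ ≤ℤ sumℤ f
sumℤ-nonneg {n} {f} nonneg = subst (_≤ℤ sumℤ f) (sumℤ-zero n) (sumℤ-mono-≤ nonneg)

term≤sumℤ : ∀ {n} {f : Fin n → ℤ} → (∀ i → 0ℤ ≤ℤ f i) → ∀ k → f k ≤ℤ sumℤ f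
term≤sumℤ {suc n} {f} nonneg zero =
  subst (_≤ℤ sumℤ f) (ℤ.+-identityʳ (f zero)) (ℤ.+-monoʳ-≤ (f zero) (sumℤ-nonneg (λ i → nonneg (suc i))))
term≤sumℤ {suc n} {f} nonneg (suc k) =
  subst (_≤ℤ sumℤ f) (ℤ.+-identityˡ (f (suc k))) (ℤ.+-mono-≤ (nonneg zero) (term≤sumℤ (λ i → nonneg (suc i)) k))

-- Deletion sets and frustrated edges

-- x frustrates an edge of sign s between i and j when s = x_i x_j, i.e. when the edge breaks the
-- antibalanced pattern s = - x_i x_j
frustrated : Maybe Sign → Sign → Sign → Bool
frustrated (just s) a b = ⌊ s S.≟ a S.* b ⌋
frustrated nothing  a b = false

frustrated-comm : ∀ m a b → frustrated m a b ≡ frustrated m b a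
frustrated-comm (just s) a b = cong (λ c → ⌊ s S.≟ c ⌋) (S.*-comm a b)
frustrated-comm nothing  a b = refl

frustrated≡false : ∀ t a b → frustrated (just t) a b ≡ false → t S.* S.- ≡ a S.* b
frustrated≡false t a b eq with t S.≟ a S.* b
frustrated≡false t a b () | yes _
... | no t≢ab = s≢t⇒s*-≡t t≢ab

unfrustrated : ∀ t a b → t S.* S.- ≡ a S.* b → frustrated (just t) a b ≡ false
unfrustrated t a b eq with t S.≟ a S.* b
... | yes t≡ab = ⊥-elim (s*-≢s t (trans eq (≡.sym t≡ab)))
... | no _     = refl

frustratedEdges : ∀ {n} → SignedGraph n → Config n → Fin n → Fin n → Bool
frustratedEdges G x i j = frustrated (w G i j) (x i) (x j)

indicator-mono : ∀ {a b} → (a ≡ false → b ≡ false) → (if b then 1 else 0) ≤ (if a then 1 else 0)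
indicator-mono {true}  {true}  _   = ℕ.≤-refl
indicator-mono {true}  {false} _   = z≤n
indicator-mono {false} {b}     a⇒b rewrite a⇒b refl = z≤n

sizeX-mono : ∀ {n} (G : SignedGraph n) {del del′} →
  (∀ i j → i ≢ j → inX del i j ≡ false → inX del′ i j ≡ false) → sizeX G del′ ≤ sizeX G del
sizeX-mono G {del} {del′} kept = sumℕ-mono-≤ λ i → sumℕ-mono-≤ λ j → indicator-mono (summand i j)
  where
  summand : ∀ i j → (⌊ i <? j ⌋ ∧ is-just (w G i j) ∧ inX del i j) ≡ false →
                    (⌊ i <? j ⌋ ∧ is-just (w G i j) ∧ inX del′ i j) ≡ false
  summand i j with i <? j | is-just (w G i j)
  ... | no  _   | _     = λ _ → refl
  ... | yes _   | false = λ _ → refl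
  ... | yes i<j | true  = kept i j (<⇒≢ i<j)

module _ {n : ℕ} (G : SignedGraph n) where

  remaining-loopless : ∀ del → Loopless (remaining G del)
  remaining-loopless del v with v ≟ v
  ... | yes _  = refl
  ... | no v≢v = ⊥-elim (v≢v refl)

  remaining-symmetric : ∀ del → IsSymmetric (remaining G del)
  remaining-symmetric del u v with u ≟ v | v ≟ u
  ... | yes _   | yes _   = refl
  ... | yes u≡v | no v≢u  = ⊥-elim (v≢u (≡.sym u≡v))
  ... | no u≢v  | yes v≡u = ⊥-elim (u≢v (≡.sym v≡u))
  ... | no _    | no _    =
    cong₂ (λ d e → if d then nothing else e) (∨-comm (del u v) (del v u)) (SignedGraph.sym G u v)

  remaining≡just : ∀ del u v {s} → remaining G del u v ≡ just s → w G u v ≡ just s × inX del u v ≡ false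
  remaining≡just del u v eq with ⌊ u ≟ v ⌋ | inX del u v
  remaining≡just del u v () | true  | _
  remaining≡just del u v () | false | true
  ... | false | false = eq , refl

  remaining-unmarked : ∀ del u v → u ≢ v → inX del u v ≡ false → remaining G del u v ≡ w G u v
  remaining-unmarked del u v u≢v unmarked with u ≟ v
  ... | yes u≡v = ⊥-elim (u≢v u≡v)
  ... | no  _   rewrite unmarked = refl

  frustratedEdges-sym : ∀ x i j → frustratedEdges G x j i ≡ frustratedEdges G x i j
  frustratedEdges-sym x i j = trans (cong (λ m → frustrated m (x j) (x i)) (SignedGraph.sym G j i))
                                    (frustrated-comm (w G i j) (x j) (x i))

  remaining-frustrated-signedBy : ∀ x → SignedBy (negate (remaining G (frustratedEdges G x))) x
  remaining-frustrated-signedBy x u v s eq with ⊗≡just {remaining G (frustratedEdges G x) u v} eq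
  ... | t , _ , eqt , refl , refl with remaining≡just (frustratedEdges G x) u v eqt
  ... | wuv , unmarked = frustrated≡false t (x u) (x v) (subst (λ m → frustrated m (x u) (x v) ≡ false) wuv (∨-conicalˡ _ _ unmarked))

  frustrated⊆deleted : ∀ del x → SignedBy (negate (remaining G del)) x →
    ∀ i j → i ≢ j → inX del i j ≡ false → inX (frustratedEdges G x) i j ≡ false
  frustrated⊆deleted del x signed i j i≢j unmarked
    rewrite frustratedEdges-sym x i j with w G i j in wij
  ... | nothing = refl
  ... | just t  = cong (λ b → b ∨ b) (unfrustrated t (x i) (x j) (signed i j (t S.* S.-) negated))
    where
    negated : negate (remaining G del) i j ≡ just (t S.* S.-)
    negated = cong (_⊗ just S.-) (trans (remaining-unmarked del i j i≢j unmarked) wij)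

  negate-symmetric : ∀ {e : EdgeSigns n} → IsSymmetric e → IsSymmetric (negate e)
  negate-symmetric symmetric u v = cong (_⊗ just S.-) (symmetric u v)

  rho≤frustration : ∀ {r} → IsRho G r → ∀ x → r ≤ sizeX G (frustratedEdges G x)
  rho≤frustration (_ , minimal) x = minimal (frustratedEdges G x) λ c s _ _ →
    balancedWalks-negate⇒antibalancedWalks _ (signedBy⇒balancedWalks _ x (remaining-frustrated-signedBy x)) c s

  ∃-frustration≤rho : ∀ {r} → IsRho G r → ∃ λ x → sizeX G (frustratedEdges G x) ≤ r
  ∃-frustration≤rho ((del , size≡r , antibalanced) , _) =
    let x , signed = balancedWalks⇒signedBy (negate e) (negate-symmetric (remaining-symmetric del)) balanced
    in x , subst (sizeX G (frustratedEdges G x) ≤_) size≡r (sizeX-mono G {del} {frustratedEdges G x} (frustrated⊆deleted del x signed))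
    where
    e : EdgeSigns n
    e = remaining G del
    balanced : BalancedWalks (negate e)
    balanced = antibalancedWalks⇒balancedWalks-negate e
                 (antibalanced⇒antibalancedWalks e (remaining-symmetric del) (remaining-loopless del) antibalanced)

-- Energy of a configuration

⌊⌋-true : ∀ {A : Set} (a? : Dec A) → A → ⌊ a? ⌋ ≡ true
⌊⌋-true a? a = trans (isYes≗does a?) (dec-true a? a)

⌊⌋-false : ∀ {A : Set} (a? : Dec A) → ¬ A → ⌊ a? ⌋ ≡ false
⌊⌋-false a? ¬a = trans (isYes≗does a?) (dec-false a? ¬a)

module _ {n : ℕ} (M : Fin n → Fin n → ℤ) where

  upper : Fin n → Fin n → ℤ
  upper i j = if ⌊ i <? j ⌋ then M i j else 0ℤ

  diagonal : Fin n → Fin n → ℤ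
  diagonal i j = if ⌊ i ≟ j ⌋ then M i j else 0ℤ

  sumℤ-symmetric : (∀ i j → M i j ≡ M j i) →
    sumℤ (λ i → sumℤ (M i)) ≡ sumℤ (λ i → sumℤ (upper i)) + sumℤ (λ i → sumℤ (upper i)) + sumℤ (λ i → M i i)
  sumℤ-symmetric symmetric = begin
    sumℤ (λ i → sumℤ (M i))
      ≡⟨ sumℤ-cong (λ i → sumℤ-cong (split i)) ⟩
    sumℤ (λ i → sumℤ (λ j → upper i j + upper j i + diagonal i j))
      ≡⟨ sumℤ-cong (λ i → trans (sumℤ-distrib-+ (λ j → upper i j + upper j i) (diagonal i))
                                (cong (_+ sumℤ (diagonal i)) (sumℤ-distrib-+ (upper i) (λ j → upper j i)))) ⟩
    sumℤ (λ i → sumℤ (upper i) + sumℤ (λ j → upper j i) + sumℤ (diagonal i))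
      ≡⟨ trans (sumℤ-distrib-+ (λ i → sumℤ (upper i) + sumℤ (λ j → upper j i)) (λ i → sumℤ (diagonal i)))
               (cong (_+ sumℤ (λ i → sumℤ (diagonal i))) (sumℤ-distrib-+ (λ i → sumℤ (upper i)) (λ i → sumℤ (λ j → upper j i)))) ⟩
    sumℤ (λ i → sumℤ (upper i)) + sumℤ (λ i → sumℤ (λ j → upper j i)) + sumℤ (λ i → sumℤ (diagonal i))
      ≡⟨ cong₂ (λ a b → sumℤ (λ i → sumℤ (upper i)) + a + b) (≡.sym (sumℤ-comm upper)) (sumℤ-cong diagonal-sum) ⟩
    sumℤ (λ i → sumℤ (upper i)) + sumℤ (λ i → sumℤ (upper i)) + sumℤ (λ i → M i i) ∎
    where
    open ≡-Reasoning
    split : ∀ i j → M i j ≡ upper i j + upper j i + diagonal i j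
    split i j with <-cmp i j
    ... | tri< i<j i≢j _ rewrite ⌊⌋-true (i <? j) i<j | ⌊⌋-false (j <? i) (ℕ.<-asym i<j) | ⌊⌋-false (i ≟ j) i≢j =
      lemma (M i j)
      where
      lemma : ∀ a → a ≡ a + 0ℤ + 0ℤ
      lemma = solve-∀
    ... | tri> _ i≢j j<i rewrite ⌊⌋-false (i <? j) (ℕ.<-asym j<i) | ⌊⌋-true (j <? i) j<i | ⌊⌋-false (i ≟ j) i≢j =
      trans (symmetric i j) (lemma (M j i))
      where
      lemma : ∀ a → a ≡ 0ℤ + a + 0ℤ
      lemma = solve-∀
    ... | tri≈ _ refl _ rewrite ⌊⌋-false (i <? i) (ℕ.<-irrefl refl) | ⌊⌋-true (i ≟ i) refl =
      ≡.sym (ℤ.+-identityˡ (M i i))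
    diagonal-sum : ∀ i → sumℤ (diagonal i) ≡ M i i
    diagonal-sum i = trans (sumℤ-single (diagonal i) i off-diagonal) on-diagonal
      where
      off-diagonal : ∀ j → j ≢ i → diagonal i j ≡ 0ℤ
      off-diagonal j j≢i rewrite ⌊⌋-false (i ≟ j) (j≢i ∘ ≡.sym) = refl
      on-diagonal : diagonal i i ≡ M i i
      on-diagonal rewrite ⌊⌋-true (i ≟ i) refl = refl

weight : Maybe Sign → ℤ
weight (just s) = signℤ s
weight nothing  = 0ℤ

W≡weight : ∀ {n} (G : SignedGraph n) i j → W G i j ≡ weight (w G i j)
W≡weight G i j with w G i j
... | just s  = refl
... | nothing = refl

edge-coupling : ∀ m a b →
  signℤ a * (weight m * signℤ b) ≡ + 2 * + (if is-just m ∧ frustrated m a b then 1 else 0) - + (if is-just m then 1 else 0)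
edge-coupling nothing      S.+ b   = refl
edge-coupling nothing      S.- b   = refl
edge-coupling (just S.+)   S.+ S.+ = refl
edge-coupling (just S.+)   S.+ S.- = refl
edge-coupling (just S.+)   S.- S.+ = refl
edge-coupling (just S.+)   S.- S.- = refl
edge-coupling (just S.-)   S.+ S.+ = refl
edge-coupling (just S.-)   S.+ S.- = refl
edge-coupling (just S.-)   S.- S.+ = refl
edge-coupling (just S.-)   S.- S.- = refl

loop-coupling : ∀ m a → signℤ a * (weight m * signℤ a) ≡ + isPosLoop m - + isNegLoop m
loop-coupling nothing    S.+ = refl
loop-coupling nothing    S.- = refl
loop-coupling (just S.+) S.+ = refl
loop-coupling (just S.+) S.- = refl
loop-coupling (just S.-) S.+ = refl
loop-coupling (just S.-) S.- = refl

frustrationEnergy : ∀ {n} → SignedGraph n → ℕ → ℤ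
frustrationEnergy G k = (+ 2 * + k - + numEdges G) + (+ 2 * + k - + numEdges G) + (+ numPosLoops G - + numNegLoops G)

sumℤ-counts : ∀ {n} (f g : Fin n → Fin n → ℕ) →
  sumℤ (λ i → sumℤ (λ j → + 2 * + f i j - + g i j)) ≡ + 2 * + sumℕ (λ i → sumℕ (f i)) - + sumℕ (λ i → sumℕ (g i))
sumℤ-counts f g = begin
  sumℤ (λ i → sumℤ (λ j → + 2 * + f i j - + g i j))  ≡⟨ sumℤ-cong row ⟩
  sumℤ (λ i → + 2 * F i - G′ i)                      ≡⟨ sumℤ-distrib-- (λ i → + 2 * F i) G′ ⟩
  sumℤ (λ i → + 2 * F i) - sumℤ G′                   ≡⟨ cong (_- sumℤ G′) (≡.sym (*-distribˡ-sumℤ (+ 2) F)) ⟩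
  + 2 * sumℤ F - sumℤ G′                             ≡⟨ cong₂ (λ a b → + 2 * a - b) (≡.sym (double f)) (≡.sym (double g)) ⟩
  + 2 * + sumℕ (λ i → sumℕ (f i)) - + sumℕ (λ i → sumℕ (g i)) ∎
  where
  open ≡-Reasoning
  F G′ : Fin _ → ℤ
  F i = sumℤ (λ j → + f i j)
  G′ i = sumℤ (λ j → + g i j)
  row : ∀ i → sumℤ (λ j → + 2 * + f i j - + g i j) ≡ + 2 * F i - G′ i
  row i = trans (sumℤ-distrib-- (λ j → + 2 * + f i j) (λ j → + g i j))
                (cong (_- G′ i) (≡.sym (*-distribˡ-sumℤ (+ 2) (λ j → + f i j))))
  double : ∀ h → + sumℕ (λ i → sumℕ (h i)) ≡ sumℤ (λ i → sumℤ (λ j → + h i j))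
  double h = trans (+-sumℕ (λ i → sumℕ (h i))) (sumℤ-cong (λ i → +-sumℕ (h i)))

module _ {n : ℕ} (G : SignedGraph n) where

  localField : Config n → Fin n → ℤ
  localField x i = sumℤ (λ j → W G i j * signℤ (x j))

  coupling : Config n → Fin n → Fin n → ℤ
  coupling x i j = signℤ (x i) * (W G i j * signℤ (x j))

  energy : Config n → ℤ
  energy x = sumℤ (λ i → sumℤ (coupling x i))

  coupling-sym : ∀ x i j → coupling x i j ≡ coupling x j i
  coupling-sym x i j = trans (cong (λ c → signℤ (x i) * (c * signℤ (x j))) (W-sym i j)) (lemma (signℤ (x i)) (W G j i) (signℤ (x j)))
    where
    W-sym : ∀ i j → W G i j ≡ W G j i
    W-sym i j = trans (W≡weight G i j) (trans (cong weight (SignedGraph.sym G i j)) (≡.sym (W≡weight G j i)))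
    lemma : ∀ a c b → a * (c * b) ≡ b * (c * a)
    lemma = solve-∀

  energy-localField : ∀ x → energy x ≡ sumℤ (λ i → signℤ (x i) * localField x i)
  energy-localField x = sumℤ-cong (λ i → ≡.sym (*-distribˡ-sumℤ (signℤ (x i)) (λ j → W G i j * signℤ (x j))))

  energy≡frustrationEnergy : ∀ x → energy x ≡ frustrationEnergy G (sizeX G (frustratedEdges G x))
  energy≡frustrationEnergy x = begin
    energy x
      ≡⟨ sumℤ-symmetric (coupling x) (coupling-sym x) ⟩
    sumℤ (λ i → sumℤ (upper (coupling x) i)) + sumℤ (λ i → sumℤ (upper (coupling x) i)) + sumℤ (λ i → coupling x i i)
      ≡⟨ cong₂ (λ a b → a + a + b) edges loops ⟩
    frustrationEnergy G (sizeX G (frustratedEdges G x)) ∎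
    where
    open ≡-Reasoning
    frustratedCount edgeCount : Fin n → Fin n → ℕ
    frustratedCount i j = if ⌊ i <? j ⌋ ∧ is-just (w G i j) ∧ inX (frustratedEdges G x) i j then 1 else 0
    edgeCount i j = if ⌊ i <? j ⌋ ∧ is-just (w G i j) then 1 else 0
    upper-coupling : ∀ i j → upper (coupling x) i j ≡ + 2 * + frustratedCount i j - + edgeCount i j
    upper-coupling i j with i <? j
    ... | no  _ = refl
    ... | yes _ rewrite frustratedEdges-sym G x i j | ∨-idem (frustratedEdges G x i j) | W≡weight G i j =
      edge-coupling (w G i j) (x i) (x j)
    edges : sumℤ (λ i → sumℤ (upper (coupling x) i)) ≡ + 2 * + sizeX G (frustratedEdges G x) - + numEdges G
    edges = trans (sumℤ-cong (λ i → sumℤ-cong (upper-coupling i))) (sumℤ-counts frustratedCount edgeCount)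
    loops : sumℤ (λ i → coupling x i i) ≡ + numPosLoops G - + numNegLoops G
    loops = begin
      sumℤ (λ i → coupling x i i)
        ≡⟨ sumℤ-cong (λ i → trans (cong (λ c → signℤ (x i) * (c * signℤ (x i))) (W≡weight G i i)) (loop-coupling (w G i i) (x i))) ⟩
      sumℤ (λ i → + isPosLoop (w G i i) - + isNegLoop (w G i i))
        ≡⟨ trans (sumℤ-distrib-- (λ i → + isPosLoop (w G i i)) (λ i → + isNegLoop (w G i i)))
                 (≡.sym (cong₂ _-_ (+-sumℕ (λ i → isPosLoop (w G i i))) (+-sumℕ (λ i → isNegLoop (w G i i))))) ⟩
      + numPosLoops G - + numNegLoops G ∎

  frustrationEnergy-mono : ∀ {k l} → k ≤ l → frustrationEnergy G k ≤ℤ frustrationEnergy G l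
  frustrationEnergy-mono {k} {l} k≤l = ℤ.+-monoˡ-≤ _ (ℤ.+-mono-≤ twice twice)
    where
    twice : + 2 * + k - + numEdges G ≤ℤ + 2 * + l - + numEdges G
    twice = ℤ.+-monoˡ-≤ (- + numEdges G) (ℤ.*-monoˡ-≤-nonNeg (+ 2) (+≤+ k≤l))

  stabilityIndex≡ : ∀ r → stabilityIndex G r ≡ - + n - frustrationEnergy G r
  stabilityIndex≡ r = lemma (+ n) (+ numPosLoops G) (+ numNegLoops G) (+ numEdges G) (+ r)
    where
    lemma : ∀ v p q m r → - v - p + q + + 2 * m - + 4 * r ≡ - v - ((+ 2 * r - m) + (+ 2 * r - m) + (p - q))
    lemma = solve-∀

-- Threshold dynamics

signℤ-opposite : ∀ s → signℤ (opposite s) ≡ - signℤ s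
signℤ-opposite S.+ = refl
signℤ-opposite S.- = refl

decide-flips : ∀ z s → decide z s ≡ opposite s → signℤ s * z ≤ℤ -1ℤ
decide-flips (+ zero)    S.+ ()
decide-flips (+ zero)    S.- ()
decide-flips (+ suc _)   S.+ ()
decide-flips (+ suc _)   S.- _ = -≤- z≤n
decide-flips -[1+ _ ]    S.+ _ = -≤- z≤n
decide-flips -[1+ _ ]    S.- ()

decide-keeps : ∀ z s → 0ℤ ≤ℤ signℤ s * z → decide z s ≡ s
decide-keeps (+ zero)  s   _ = refl
decide-keeps (+ suc _) S.+ _ = refl
decide-keeps (+ suc _) S.- ()
decide-keeps -[1+ _ ]  S.+ ()
decide-keeps -[1+ _ ]  S.- _ = refl

decide-forced : ∀ z s t → 1ℤ ≤ℤ signℤ s * z → decide z t ≡ s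
decide-forced (+ zero)  S.+ t (+≤+ ())
decide-forced (+ zero)  S.- t (+≤+ ())
decide-forced (+ suc _) S.+ t _ = refl
decide-forced (+ suc _) S.- t ()
decide-forced -[1+ _ ]  S.+ t ()
decide-forced -[1+ _ ]  S.- t _ = refl

decide-against : ∀ s → decide (- signℤ s) s ≡ opposite s
decide-against S.+ = refl
decide-against S.- = refl

i+i≤-2⇒i≤-1 : ∀ a → a + a ≤ℤ -[1+ 1 ] → a ≤ℤ -1ℤ
i+i≤-2⇒i≤-1 -[1+ _ ] _ = -≤- z≤n

≤-via-difference : ∀ {a b} d → 0ℤ ≤ℤ d → b ≡ a + d → a ≤ℤ b
≤-via-difference {a} d 0≤d refl = subst (_≤ℤ a + d) (ℤ.+-identityʳ a) (ℤ.+-monoʳ-≤ a 0≤d)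

module _ {n : ℕ} (G : SignedGraph n) where

  localField-opposite : ∀ x i → localField G (opposite ∘ x) i ≡ - localField G x i
  localField-opposite x i = trans (sumℤ-cong term) (sumℤ-neg (λ j → W G i j * signℤ (x j)))
    where
    term : ∀ j → W G i j * signℤ (opposite (x j)) ≡ - (W G i j * signℤ (x j))
    term j = trans (cong (W G i j *_) (signℤ-opposite (x j))) (≡.sym (ℤ.neg-distribʳ-* (W G i j) _))

  step-cong : ∀ b {y z : Config n} → (∀ j → y j ≡ z j) → ∀ i → step G b y i ≡ step G b z i
  step-cong b y≗z i = cong₂ decide (cong (_- b i) (sumℤ-cong (λ j → cong (λ s → W G i j * signℤ s) (y≗z j)))) (y≗z i)

  totalTwoCycle⇒antialigned : ∀ b x → TotalTwoCycle G b x → ∀ i → signℤ (x i) * localField G x i ≤ℤ -1ℤ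
  totalTwoCycle⇒antialigned b x (returns , flips) i =
    i+i≤-2⇒i≤-1 (s * h) (subst (_≤ℤ -[1+ 1 ]) (sum (s * h) (s * b i)) (ℤ.+-mono-≤ first second))
    where
    s h : ℤ
    s = signℤ (x i)
    h = localField G x i
    flipped : ∀ j → step G b x j ≡ opposite (x j)
    flipped j = s≢t⇒s≡opposite[t] (flips j)
    back : decide (- h - b i) (opposite (x i)) ≡ opposite (opposite (x i))
    back = begin
      decide (- h - b i) (opposite (x i))        ≡⟨ cong (λ h′ → decide (h′ - b i) (opposite (x i))) (localField-opposite x i) ⟨
      step G b (opposite ∘ x) i                  ≡⟨ step-cong b flipped i ⟨
      step G b (step G b x) i                    ≡⟨ returns i ⟩
      x i                                        ≡⟨ S.opposite-involutive (x i) ⟨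
      opposite (opposite (x i))                  ∎
      where open ≡-Reasoning
    first : s * h - s * b i ≤ℤ -1ℤ
    first = subst (_≤ℤ -1ℤ) (expand s h (b i)) (decide-flips _ (x i) (flipped i))
      where
      expand : ∀ s h t → s * (h - t) ≡ s * h - s * t
      expand = solve-∀
    second : s * h + s * b i ≤ℤ -1ℤ
    second = subst (_≤ℤ -1ℤ) (trans (cong (_* (- h - b i)) (signℤ-opposite (x i))) (expand s h (b i)))
                   (decide-flips _ (opposite (x i)) back)
      where
      expand : ∀ s h t → - s * (- h - t) ≡ s * h + s * t
      expand = solve-∀
    sum : ∀ a c → (a - c) + (a + c) ≡ a + a
    sum = solve-∀

  totalTwoCycle⇒energy≤-n : ∀ b x → TotalTwoCycle G b x → energy G x ≤ℤ - + n
  totalTwoCycle⇒energy≤-n b x cycle = begin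
    energy G x                                    ≡⟨ energy-localField G x ⟩
    sumℤ (λ i → signℤ (x i) * localField G x i)  ≤⟨ sumℤ-mono-≤ (totalTwoCycle⇒antialigned b x cycle) ⟩
    sumℤ {n} (λ _ → -1ℤ)                          ≡⟨ sumℤ-const n -1ℤ ⟩
    + n * -1ℤ                                     ≡⟨ ℤ.*-comm (+ n) -1ℤ ⟩
    -1ℤ * + n                                     ≡⟨ ℤ.-1*i≡-i (+ n) ⟩
    - + n                                         ∎
    where open ℤ.≤-Reasoning

-- Peeling a vertex set down to mutually antialigned vertices

𝟙 : Bool → ℤ
𝟙 true  = 1ℤ
𝟙 false = 0ℤ

module _ {n : ℕ} where

  sumOver : (Fin n → Bool) → (Fin n → ℤ) → ℤ
  sumOver A f = sumℤ (λ k → 𝟙 (A k) * f k)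

  size : (Fin n → Bool) → ℤ
  size A = sumOver A (λ _ → 1ℤ)

  remove : (Fin n → Bool) → Fin n → Fin n → Bool
  remove A i k = if ⌊ i ≟ k ⌋ then false else A k

  sumOver-all : ∀ f → sumOver (λ _ → true) f ≡ sumℤ f
  sumOver-all f = sumℤ-cong (λ k → ℤ.*-identityˡ (f k))

  sumOver-distrib-- : ∀ A f g → sumOver A (λ k → f k - g k) ≡ sumOver A f - sumOver A g
  sumOver-distrib-- A f g = trans (sumℤ-cong (λ k → distrib (𝟙 (A k)) (f k) (g k)))
                                  (sumℤ-distrib-- (λ k → 𝟙 (A k) * f k) (λ k → 𝟙 (A k) * g k))
    where
    distrib : ∀ a x y → a * (x - y) ≡ a * x - a * y
    distrib = solve-∀

  sumOver-empty : ∀ A f → (∀ k → A k ≢ true) → sumOver A f ≡ 0ℤ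
  sumOver-empty A f empty = trans (sumℤ-cong term) (sumℤ-zero n)
    where
    term : ∀ k → 𝟙 (A k) * f k ≡ 0ℤ
    term k with A k in Ak
    ... | true  = ⊥-elim (empty k Ak)
    ... | false = refl

  size≥1 : ∀ A k → A k ≡ true → 1ℤ ≤ℤ size A
  size≥1 A k Ak = subst (_≤ℤ size A) (cong (λ b → 𝟙 b * 1ℤ) Ak) (term≤sumℤ nonneg k)
    where
    nonneg : ∀ k → 0ℤ ≤ℤ 𝟙 (A k) * 1ℤ
    nonneg k with A k
    ... | true  = +≤+ z≤n
    ... | false = +≤+ z≤n

  sumOver-remove : ∀ A i → A i ≡ true → ∀ f → sumOver (remove A i) f ≡ sumOver A f - f i
  sumOver-remove A i Ai f = begin
    sumOver (remove A i) f                             ≡⟨ solve-rearrange (sumOver A f) (sumOver (remove A i) f) ⟩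
    sumOver A f - (sumOver A f - sumOver (remove A i) f) ≡⟨ cong (_-_ (sumOver A f)) difference ⟩
    sumOver A f - f i                                   ∎
    where
    open ≡-Reasoning
    solve-rearrange : ∀ a b → b ≡ a - (a - b)
    solve-rearrange = solve-∀
    d : Fin n → ℤ
    d k = 𝟙 (A k) * f k - 𝟙 (remove A i k) * f k
    others : ∀ k → k ≢ i → d k ≡ 0ℤ
    others k k≢i rewrite ⌊⌋-false (i ≟ k) (k≢i ∘ ≡.sym) = ℤ.+-inverseʳ (𝟙 (A k) * f k)
    at-i : d i ≡ f i
    at-i rewrite ⌊⌋-true (i ≟ i) refl | Ai = trans (ℤ.+-identityʳ (1ℤ * f i)) (ℤ.*-identityˡ (f i))
    difference : sumOver A f - sumOver (remove A i) f ≡ f i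
    difference = trans (≡.sym (sumℤ-distrib-- (λ k → 𝟙 (A k) * f k) (λ k → 𝟙 (remove A i k) * f k)))
                       (trans (sumℤ-single d i others) at-i)

-- Deleting from A a vertex with nonnegative row sum does not increase the potential (potential-remove,
-- M_ii ≤ 1) and, while the potential is nonpositive, never empties A (alone⇒potential≥1).
module Peeling {n : ℕ} (M : Fin n → Fin n → ℤ)
               (M-sym : ∀ i j → M i j ≡ M j i) (M-diag : ∀ i → M i i ≤ℤ 1ℤ) where

  rowSum : (Fin n → Bool) → Fin n → ℤ
  rowSum A i = sumOver A (M i)

  potential : (Fin n → Bool) → ℤ
  potential A = sumOver A (rowSum A) + size A

  Settled : (Fin n → Bool) → Set
  Settled A = ∀ i → A i ≡ true → rowSum A i ≤ℤ -1ℤ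

  rowSum-remove : ∀ A i → A i ≡ true → ∀ k → rowSum (remove A i) k ≡ rowSum A k - M k i
  rowSum-remove A i Ai k = sumOver-remove A i Ai (M k)

  potential-remove : ∀ A i → A i ≡ true →
    potential A ≡ potential (remove A i) + (rowSum A i + rowSum (remove A i) i + 1ℤ)
  potential-remove A i Ai = begin
    potential A
      ≡⟨ rearrange (sumOver A (rowSum A)) (size A) (rowSum A i) (M i i) ⟩
    ((sumOver A (rowSum A) - rowSum A i) - (rowSum A i - M i i)) + (size A - 1ℤ) + (rowSum A i + (rowSum A i - M i i) + 1ℤ)
      ≡⟨ cong₂ (λ m r → (m - (rowSum A i - M i i)) + (size A - 1ℤ) + (rowSum A i + r + 1ℤ))
               (cong (_-_ (sumOver A (rowSum A))) column) (≡.sym (rowSum-remove A i Ai i)) ⟩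
    ((sumOver A (rowSum A) - sumOver A (λ k → M k i)) - (rowSum A i - M i i)) + (size A - 1ℤ) + (rowSum A i + rowSum A′ i + 1ℤ)
      ≡⟨ cong₂ (λ m c → m + c + (rowSum A i + rowSum A′ i + 1ℤ)) mass′ (≡.sym (sumOver-remove A i Ai (λ _ → 1ℤ))) ⟩
    potential A′ + (rowSum A i + rowSum A′ i + 1ℤ) ∎
    where
    open ≡-Reasoning
    A′ : Fin n → Bool
    A′ = remove A i
    rearrange : ∀ m s c d → m + s ≡ ((m - c) - (c - d)) + (s - 1ℤ) + (c + (c - d) + 1ℤ)
    rearrange = solve-∀
    column : rowSum A i ≡ sumOver A (λ k → M k i)
    column = sumℤ-cong (λ k → cong (𝟙 (A k) *_) (M-sym i k))
    mass′ : (sumOver A (rowSum A) - sumOver A (λ k → M k i)) - (rowSum A i - M i i) ≡ sumOver A′ (rowSum A′)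
    mass′ = begin
      (sumOver A (rowSum A) - sumOver A (λ k → M k i)) - (rowSum A i - M i i)
        ≡⟨ cong (_- (rowSum A i - M i i)) (≡.sym (sumOver-distrib-- A (rowSum A) (λ k → M k i))) ⟩
      sumOver A (λ k → rowSum A k - M k i) - (rowSum A i - M i i)
        ≡⟨ ≡.sym (sumOver-remove A i Ai (λ k → rowSum A k - M k i)) ⟩
      sumOver A′ (λ k → rowSum A k - M k i)
        ≡⟨ sumℤ-cong (λ k → cong (𝟙 (A′ k) *_) (≡.sym (rowSum-remove A i Ai k))) ⟩
      sumOver A′ (rowSum A′) ∎

  alone⇒potential≥1 : ∀ A i → A i ≡ true → 0ℤ ≤ℤ rowSum A i → (∀ j → remove A i j ≢ true) → 1ℤ ≤ℤ potential A
  alone⇒potential≥1 A i Ai 0≤r alone = ≤-via-difference (rowSum A i) 0≤r (begin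
    potential A                                                          ≡⟨ potential-remove A i Ai ⟩
    potential (remove A i) + (rowSum A i + rowSum (remove A i) i + 1ℤ)   ≡⟨ cong₂ (λ p q → p + (rowSum A i + q + 1ℤ)) (cong₂ _+_ (vanish _) (vanish _)) (vanish (M i)) ⟩
    0ℤ + 0ℤ + (rowSum A i + 0ℤ + 1ℤ)                                     ≡⟨ rearrange (rowSum A i) ⟩
    1ℤ + rowSum A i                                                      ∎)
    where
    open ≡-Reasoning
    vanish : ∀ f → sumOver (remove A i) f ≡ 0ℤ
    vanish f = sumOver-empty (remove A i) f alone
    rearrange : ∀ r → 0ℤ + 0ℤ + (r + 0ℤ + 1ℤ) ≡ 1ℤ + r
    rearrange = solve-∀

  peel : ∀ bound A k → size A ≤ℤ + bound → A k ≡ true → potential A ≤ℤ 0ℤ →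
         Σ (Fin n → Bool) λ A′ → (∃ λ k → A′ k ≡ true) × Settled A′
  peel zero A k small Ak _ with +≤+ () ← ℤ.≤-trans (size≥1 A k Ak) small
  peel (suc bound) A k small Ak nonpos with any? (λ i → (A i Bool.≟ true) ×-dec (0ℤ ℤ.≤? rowSum A i))
  ... | no settled = A , (k , Ak) , λ i Ai → ℤ.i<j⇒i≤pred[j] (ℤ.≰⇒> (λ 0≤r → settled (i , Ai , 0≤r)))
  ... | yes (i , Ai , 0≤r) with any? (λ j → remove A i j Bool.≟ true)
  ...   | yes (j , A′j) = peel bound (remove A i) j smaller A′j nonpos′
    where
    smaller : size (remove A i) ≤ℤ + bound
    smaller = subst (_≤ℤ + bound) (≡.sym (sumOver-remove A i Ai (λ _ → 1ℤ))) (ℤ.+-monoˡ-≤ -1ℤ small)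
    decrease : 0ℤ ≤ℤ rowSum A i + rowSum (remove A i) i + 1ℤ
    decrease = subst (0ℤ ≤ℤ_) (trans (rearrange (rowSum A i) (M i i)) (cong (λ q → rowSum A i + q + 1ℤ) (≡.sym (rowSum-remove A i Ai i))))
                     (ℤ.+-mono-≤ 0≤r (ℤ.+-mono-≤ 0≤r (ℤ.i≤j⇒0≤j-i (M-diag i))))
      where
      rearrange : ∀ r m → r + (r + (1ℤ - m)) ≡ r + (r - m) + 1ℤ
      rearrange = solve-∀
    nonpos′ : potential (remove A i) ≤ℤ 0ℤ
    nonpos′ = ℤ.≤-trans (≤-via-difference _ decrease (potential-remove A i Ai)) nonpos
  ...   | no empty with +≤+ () ← ℤ.≤-trans (alone⇒potential≥1 A i Ai 0≤r (λ j A′j → empty (j , A′j))) nonpos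

-- Thresholds under which a settled set flips back and forth

keepThreshold : Sign → ℤ → ℤ → ℤ
keepThreshold S.+ a c = a ⊓ c
keepThreshold S.- a c = a ⊔ c

negate-difference : ∀ a t → t - a ≡ - 1ℤ * (a - t)
negate-difference = solve-∀

keepThreshold-left : ∀ s a c → 0ℤ ≤ℤ signℤ s * (a - keepThreshold s a c)
keepThreshold-left S.+ a c = subst (0ℤ ≤ℤ_) (≡.sym (ℤ.*-identityˡ _)) (ℤ.i≤j⇒0≤j-i (ℤ.i⊓j≤i a c))
keepThreshold-left S.- a c = subst (0ℤ ≤ℤ_) (negate-difference a (a ⊔ c)) (ℤ.i≤j⇒0≤j-i (ℤ.i≤i⊔j a c))

keepThreshold-right : ∀ s a c → 0ℤ ≤ℤ signℤ s * (c - keepThreshold s a c)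
keepThreshold-right S.+ a c = subst (0ℤ ≤ℤ_) (≡.sym (ℤ.*-identityˡ _)) (ℤ.i≤j⇒0≤j-i (ℤ.i⊓j≤j a c))
keepThreshold-right S.- a c = subst (0ℤ ≤ℤ_) (negate-difference c (a ⊔ c)) (ℤ.i≤j⇒0≤j-i (ℤ.i≤j⇒i≤k⊔j a (ℤ.≤-refl {c})))

signℤ[s]*signℤ[s]≡1 : ∀ s → signℤ s * signℤ s ≡ 1ℤ
signℤ[s]*signℤ[s]≡1 S.+ = refl
signℤ[s]*signℤ[s]≡1 S.- = refl

flipIf : Bool → Sign → Sign
flipIf true  s = opposite s
flipIf false s = s

flipIf-split : ∀ b v s → v * signℤ s ≡ v * signℤ (flipIf b s) + + 2 * (𝟙 b * (v * signℤ s))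
flipIf-split true  v s = trans (lemma v (signℤ s)) (cong (λ t → v * t + + 2 * (1ℤ * (v * signℤ s))) (≡.sym (signℤ-opposite s)))
  where
  lemma : ∀ v t → v * t ≡ v * - t + + 2 * (1ℤ * (v * t))
  lemma = solve-∀
flipIf-split false v s = lemma v (signℤ s)
  where
  lemma : ∀ v t → v * t ≡ v * t + + 2 * (0ℤ * (v * t))
  lemma = solve-∀

-- Vertices outside A keep their state under both x and its flip on A; a vertex of A is pushed to
-- the opposite state by the field -x_i at x and back by the field -2 x_i Σ_{j∈A} w_ij x_j - x_i at the flip.
module _ {n : ℕ} (G : SignedGraph n) (x : Config n) (A : Fin n → Bool) where

  flipped : Config n
  flipped k = flipIf (A k) (x k)

  threshold : Fin n → ℤ
  threshold k = if A k then localField G x k + signℤ (x k) else keepThreshold (x k) (localField G x k) (localField G flipped k)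

  localField-flipped : ∀ i → localField G x i ≡ localField G flipped i + + 2 * sumOver A (λ j → W G i j * signℤ (x j))
  localField-flipped i = begin
    localField G x i
      ≡⟨ sumℤ-cong (λ j → flipIf-split (A j) (W G i j) (x j)) ⟩
    sumℤ (λ j → W G i j * signℤ (flipped j) + + 2 * (𝟙 (A j) * (W G i j * signℤ (x j))))
      ≡⟨ sumℤ-distrib-+ (λ j → W G i j * signℤ (flipped j)) (λ j → + 2 * (𝟙 (A j) * (W G i j * signℤ (x j)))) ⟩
    localField G flipped i + sumℤ (λ j → + 2 * (𝟙 (A j) * (W G i j * signℤ (x j))))
      ≡⟨ cong (_+_ (localField G flipped i)) (≡.sym (*-distribˡ-sumℤ (+ 2) (λ j → 𝟙 (A j) * (W G i j * signℤ (x j))))) ⟩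
    localField G flipped i + + 2 * sumOver A (λ j → W G i j * signℤ (x j)) ∎
    where open ≡-Reasoning

  sumOver-coupling : ∀ i → sumOver A (coupling G x i) ≡ signℤ (x i) * sumOver A (λ j → W G i j * signℤ (x j))
  sumOver-coupling i = trans (sumℤ-cong (λ j → swap (𝟙 (A j)) (signℤ (x i)) (W G i j * signℤ (x j))))
                             (≡.sym (*-distribˡ-sumℤ (signℤ (x i)) (λ j → 𝟙 (A j) * (W G i j * signℤ (x j)))))
    where
    swap : ∀ a s t → a * (s * t) ≡ s * (a * t)
    swap = solve-∀

  step-flips : ∀ i → step G threshold x i ≡ flipped i
  step-flips i = at (A i)
    where
    h : ℤ
    h = localField G x i
    at : ∀ b → decide (h - (if b then h + signℤ (x i) else keepThreshold (x i) h (localField G flipped i))) (x i) ≡ flipIf b (x i)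
    at true  = trans (cong (λ z → decide z (x i)) (cancel h (signℤ (x i)))) (decide-against (x i))
      where
      cancel : ∀ h s → h - (h + s) ≡ - s
      cancel = solve-∀
    at false = decide-keeps _ (x i) (keepThreshold-left (x i) h (localField G flipped i))

  step-flipsBack : (∀ i → A i ≡ true → sumOver A (coupling G x i) ≤ℤ -1ℤ) → ∀ i → step G threshold flipped i ≡ x i
  step-flipsBack settled i = at (A i) (settled i)
    where
    h h′ s P : ℤ
    h  = localField G x i
    h′ = localField G flipped i
    s  = signℤ (x i)
    P  = sumOver A (λ j → W G i j * signℤ (x j))
    at : ∀ b → (b ≡ true → sumOver A (coupling G x i) ≤ℤ -1ℤ) →
         decide (h′ - (if b then h + s else keepThreshold (x i) h h′)) (flipIf b (x i)) ≡ x i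
    at false _       = decide-keeps _ (x i) (keepThreshold-right (x i) h h′)
    at true  settled = decide-forced _ (x i) (opposite (x i)) (≤-via-difference _ twice-margin (begin
      s * (h′ - (h + s))                          ≡⟨ cong (λ t → s * (h′ - (t + s))) (localField-flipped i) ⟩
      s * (h′ - ((h′ + + 2 * P) + s))             ≡⟨ expand s h′ P ⟩
      - (+ 2 * (s * P)) - s * s                   ≡⟨ cong₂ (λ c q → - (+ 2 * c) - q) (≡.sym (sumOver-coupling i)) (signℤ[s]*signℤ[s]≡1 (x i)) ⟩
      - (+ 2 * c) - 1ℤ                            ≡⟨ rearrange c ⟩
      1ℤ + ((- 1ℤ - c) + (- 1ℤ - c))              ∎))
      where
      open ≡-Reasoning
      c : ℤ
      c = sumOver A (coupling G x i)
      margin : 0ℤ ≤ℤ - 1ℤ - c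
      margin = ℤ.i≤j⇒0≤j-i (settled refl)
      twice-margin : 0ℤ ≤ℤ (- 1ℤ - c) + (- 1ℤ - c)
      twice-margin = ℤ.+-mono-≤ margin margin
      expand : ∀ s h′ P → s * (h′ - ((h′ + + 2 * P) + s)) ≡ - (+ 2 * (s * P)) - s * s
      expand = solve-∀
      rearrange : ∀ c → - (+ 2 * c) - 1ℤ ≡ 1ℤ + ((- 1ℤ - c) + (- 1ℤ - c))
      rearrange = solve-∀

  settled⇒period2 : (∃ λ k → A k ≡ true) → (∀ i → A i ≡ true → sumOver A (coupling G x i) ≤ℤ -1ℤ) →
                    Period2 G threshold x
  settled⇒period2 (k , Ak) settled =
    (λ i → trans (step-cong G threshold step-flips i) (step-flipsBack settled i)) ,
    λ fixed → S.s≢opposite[s] (x k) (trans (≡.sym (fixed k)) (trans (step-flips k) (cong (λ b → flipIf b (x k)) Ak)))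

-- The theorem

coupling-diagonal≤1 : ∀ {n} (G : SignedGraph n) x i → coupling G x i i ≤ℤ 1ℤ
coupling-diagonal≤1 G x i rewrite W≡weight G i i | loop-coupling (w G i i) (x i) = loop≤1 (w G i i)
  where
  loop≤1 : ∀ m → + isPosLoop m - + isNegLoop m ≤ℤ 1ℤ
  loop≤1 nothing    = +≤+ z≤n
  loop≤1 (just S.+) = +≤+ (s≤s z≤n)
  loop≤1 (just S.-) = -≤+

totalTwoCycle⇒stable : ∀ {n} (G : SignedGraph n) r → IsRho G r →
  (Σ (Fin n → ℤ) λ b → Σ (Config n) λ x → TotalTwoCycle G b x) → + 0 ≤ℤ stabilityIndex G r
totalTwoCycle⇒stable {n} G r rho (b , x , cycle) =
  subst (0ℤ ≤ℤ_) (≡.sym (stabilityIndex≡ G r)) (ℤ.i≤j⇒0≤j-i (begin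
    frustrationEnergy G r                                ≤⟨ frustrationEnergy-mono G (rho≤frustration G rho x) ⟩
    frustrationEnergy G (sizeX G (frustratedEdges G x))  ≡⟨ energy≡frustrationEnergy G x ⟨
    energy G x                                           ≤⟨ totalTwoCycle⇒energy≤-n G b x cycle ⟩
    - + n                                                ∎))
  where open ℤ.≤-Reasoning

stable⇒period2 : ∀ {n} (G : SignedGraph n) r → IsRho G r → 1 ≤ n → + 0 ≤ℤ stabilityIndex G r →
  Σ (Fin n → ℤ) λ b → Σ (Config n) λ x → Period2 G b x
stable⇒period2 {suc n} G r rho _ stable =
  let A , nonempty , settled = peel (suc n) everything zero (ℤ.≤-reflexive size-everything) refl potential≤0
  in threshold G x A , x , settled⇒period2 G x A nonempty settled
  where
  x : Config (suc n)
  x = proj₁ (∃-frustration≤rho G rho)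
  open Peeling (coupling G x) (coupling-sym G x) (coupling-diagonal≤1 G x)
  everything : Fin (suc n) → Bool
  everything _ = true
  size-everything : size everything ≡ + suc n
  size-everything = trans (sumOver-all {suc n} (λ _ → 1ℤ)) (trans (sumℤ-const (suc n) 1ℤ) (ℤ.*-identityʳ (+ suc n)))
  energy≤-n : energy G x ≤ℤ - + suc n
  energy≤-n = begin
    energy G x                                           ≡⟨ energy≡frustrationEnergy G x ⟩
    frustrationEnergy G (sizeX G (frustratedEdges G x))  ≤⟨ frustrationEnergy-mono G (proj₂ (∃-frustration≤rho G rho)) ⟩
    frustrationEnergy G r                                ≤⟨ ℤ.0≤i-j⇒j≤i (subst (0ℤ ≤ℤ_) (stabilityIndex≡ G r) stable) ⟩
    - + suc n                                            ∎
    where open ℤ.≤-Reasoning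
  potential≤0 : potential everything ≤ℤ 0ℤ
  potential≤0 = begin
    potential everything                  ≡⟨ cong₂ _+_ (trans (sumOver-all (rowSum everything)) (sumℤ-cong (λ i → sumOver-all (coupling G x i)))) size-everything ⟩
    energy G x + + suc n                  ≤⟨ ℤ.+-monoˡ-≤ (+ suc n) energy≤-n ⟩
    - + suc n + + suc n                   ≡⟨ ℤ.+-inverseˡ (+ suc n) ⟩
    0ℤ                                    ∎
    where open ℤ.≤-Reasoning

theorem4 : ∀ {n : ℕ} (G : SignedGraph n) (r : ℕ) → IsRho G r →
    ((Σ (Fin n → ℤ) λ b → Σ (Config n) λ x → TotalTwoCycle G b x) →
       + 0 ≤ℤ stabilityIndex G r)
    × (1 ≤ n → + 0 ≤ℤ stabilityIndex G r →
       Σ (Fin n → ℤ) λ b → Σ (Config n) λ x → Period2 G b x)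
theorem4 G r rho = totalTwoCycle⇒stable G r rho , stable⇒period2 G r rho
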